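{- Let $S$ be an instance of 3-Partition (with $n_1\ge\cdots\ge n_{3m}$) and $w_S$ as defined below. Every accepting computation $\varepsilon\,\|\,w_S\vdash^*\varepsilon\,\|\,\varepsilon$ satisfies the V-Condition: for each $\ell$ with $1\le\ell\le 12m$, the symbols of the second occurrence of $v_\ell$ in $w_S$ are all matched against the corresponding symbols of the first occurrence of $v_\ell$ in $w_S$.
   Context: Queue automaton: a configuration is written $Q\,\|\,x$ ($Q$ = queue contents, $x$ = remaining input); a step from $Q\,\|\,\sigma x$ ($\sigma$ a symbol) goes either to $Q\sigma\,\|\,x$ (push the input symbol) or, if $Q=\sigma Q'$, to $Q'\,\|\,x$ (the input symbol is matched against the leftmost queue symbol, which is popped; that queue symbol was pushed from an earlier input position and the two occurrences are said to be matched). $\vdash^*$ is zero or more steps; $\varepsilon$ is the empty string; an accepting computation of $w$ is a computation $\varepsilon\,\|\,w\vdash^*\varepsilon\,\|\,\varepsilon$. An instance of 3-Partition is a sequence $S=\langle n_i:1\le i\le 3m\rangle$ of natural numbers such that $B=(\sum_{i=1}^{3m}n_i)/m$ is an integer and $B/4<n_i<B/2$ for all $i$; throughout, the $n_i$ are in non-increasing order. Alphabet $\{a_1,a_2,b,e_0,e,c_1,c_2,x,y\}$; $u^i$ is $i$ copies of $u$ concatenated, $\prod_{\ell=1}^k u_\ell=u_1\cdots u_k$. Define $U_\ell=a_1^2b^\ell a_2^2$, $v_\ell=c_1x^\ell y^\ell c_2$, $D_k=U_{n_k}^{3m-k+1}$, $E_k=U_B^{3m-k}\,a_1b^{n_k}a_2\,U_B^{3m-k}$,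 $F_k=U_B^{2(3m-k)}$, $\mathrm{Load}_S=e_0\prod_{i=1}^m(b^{2B}e)$, $\mathrm{Dist}_S=e_0\prod_{i=1}^m((a_1b^Ba_2)^3e)$, $\mathrm{Ver}_S=\prod_{k=1}^{3m}[v_{4k-3}D_kv_{4k-3}\,v_{4k-2}D_kv_{4k-2}\,v_{4k-1}E_kv_{4k-1}\,v_{4k}F_kv_{4k}]$, $w_S=\mathrm{Load}_S\mathrm{Dist}_S\mathrm{Ver}_S$. Each $v_\ell$ ($1\le\ell\le12m$) occurs exactly twice in $w_S$. -}

module Defs where

open import Data.Fin as Fin using (Fin; toℕ)
open import Data.List using (List; []; _∷_; _++_; _∷ʳ_; [_]; length; replicate; concat; tabulate)
open import Data.List.Membership.Propositional using (_∈_)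
open import Data.List.Relation.Unary.All using (All; []; _∷_)
open import Data.List.Relation.Unary.All.Properties using (∷ʳ⁺)
open import Data.Nat using (ℕ; suc; _+_; _*_; _∸_; _≤_; _<_; NonZero)
open import Data.Nat.ListAction using (sum)
open import Data.Product using (∃₂; _×_; _,_)
open import Function using (const)
open import Relation.Binary.Construct.Closure.ReflexiveTransitive using (Star; ε; _◅_)
open import Relation.Binary.PropositionalEquality using (_≡_)

module QueueAutomaton {A : Set} where

  infix 4 _∥_
  infix 3 _⊢_ _⊢*_

  record Config : Set where
    constructor _∥_
    field
      queue : List A
      input : List A

  data _⊢_ : Config → Config → Set where
    push : ∀ {Q σ x} → Q ∥ σ ∷ x ⊢ Q ∷ʳ σ ∥ x
    pop  : ∀ {Q σ x} → σ ∷ Q ∥ σ ∷ x ⊢ Q ∥ x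

  _⊢*_ : Config → Config → Set
  _⊢*_ = Star _⊢_

  AcceptingComputation : List A → Set
  AcceptingComputation w = [] ∥ w ⊢* [] ∥ []

  -- The first argument gives, for each queue symbol, the input position it was
  -- pushed from; the second is the position of the next input symbol.  A pair
  -- (j , i) is listed when the symbol at input position j is matched against
  -- the one at position i.  Positions are counted from 0.
  matchesFrom : ∀ {C D} → All (const ℕ) (Config.queue C) → ℕ → C ⊢* D → List (ℕ × ℕ)
  matchesFrom is       j ε          = []
  matchesFrom is       j (push ◅ c) = matchesFrom (∷ʳ⁺ is j) (suc j) c
  matchesFrom (i ∷ is) j (pop  ◅ c) = (j , i) ∷ matchesFrom is (suc j) c

  matches : ∀ {w} → AcceptingComputation w → List (ℕ × ℕ)
  matches = matchesFrom [] 0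

open QueueAutomaton public

_OccursAt_In_ : {A : Set} → List A → ℕ → List A → Set
u OccursAt i In w = ∃₂ λ p s → w ≡ p ++ u ++ s × length p ≡ i

record FirstTwoOccurrences {A : Set} (u w : List A) (i j : ℕ) : Set where
  field
    i<j     : i < j
    first   : u OccursAt i In w
    second  : u OccursAt j In w
    no-more : ∀ k → k < j → u OccursAt k In w → k ≡ i

-- B is characterised by B m = Σ nᵢ, and B/4 < nᵢ < B/2 is cleared of denominators.
record 3-Partition (m : ℕ) : Set where
  field
    n              : Fin (3 * m) → ℕ
    B              : ℕ
    m-nonZero      : NonZero m
    B*m≡sum        : B * m ≡ sum (tabulate n)
    B/4<n          : ∀ i → B < 4 * n i
    n<B/2          : ∀ i → 2 * n i < B
    non-increasing : ∀ {i j} → i Fin.≤ j → n j ≤ n i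

data Symbol : Set where
  a₁ a₂ b e₀ e c₁ c₂ x y : Symbol

Word : Set
Word = List Symbol

infixr 8 _^_

_^_ : Word → ℕ → Word
u ^ i = concat (replicate i u)

∏ : ∀ {k} → (Fin k → Word) → Word
∏ u = concat (tabulate u)

U : ℕ → Word
U ℓ = [ a₁ ] ^ 2 ++ [ b ] ^ ℓ ++ [ a₂ ] ^ 2

v : ℕ → Word
v ℓ = [ c₁ ] ++ [ x ] ^ ℓ ++ [ y ] ^ ℓ ++ [ c₂ ]

module _ {m : ℕ} (S : 3-Partition m) where

  open 3-Partition S

  -- An index i : Fin (3 * m) stands for k = suc (toℕ i), so that 1 ≤ k ≤ 3m
  -- and no subtraction below truncates.
  D E F : Fin (3 * m) → Word

  D i = U (n i) ^ (3 * m ∸ k + 1)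
    where k = suc (toℕ i)

  E i = U B ^ (3 * m ∸ k) ++ [ a₁ ] ++ [ b ] ^ n i ++ [ a₂ ] ++ U B ^ (3 * m ∸ k)
    where k = suc (toℕ i)

  F i = U B ^ (2 * (3 * m ∸ k))
    where k = suc (toℕ i)

  Load : Word
  Load = [ e₀ ] ++ ∏ {m} λ _ → [ b ] ^ (2 * B) ++ [ e ]

  Dist : Word
  Dist = [ e₀ ] ++ ∏ {m} λ _ → ([ a₁ ] ++ [ b ] ^ B ++ [ a₂ ]) ^ 3 ++ [ e ]

  Ver : Word
  Ver = ∏ λ i → let k = suc (toℕ i) in
       v (4 * k ∸ 3) ++ D i ++ v (4 * k ∸ 3)
    ++ v (4 * k ∸ 2) ++ D i ++ v (4 * k ∸ 2)
    ++ v (4 * k ∸ 1) ++ E i ++ v (4 * k ∸ 1)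
    ++ v (4 * k)     ++ F i ++ v (4 * k)

  wₛ : Word
  wₛ = Load ++ Dist ++ Ver

  -- The symbols of v ℓ are v ℓ at offsets t < length (v ℓ).
  V-Condition : AcceptingComputation wₛ → Set
  V-Condition c =
    ∀ ℓ → 1 ≤ ℓ → ℓ ≤ 12 * m →
    ∃₂ λ i j → FirstTwoOccurrences (v ℓ) wₛ i j ×
               (∀ t → t < length (v ℓ) → (j + t , i + t) ∈ matches c)

{-# OPTIONS --safe #-}
-- The symbols c₁, c₂, x, y form a queue computation of their own, reading
-- v₁ v₁ v₂ v₂ ⋯.  Reading one v ℓ turns a queue σ into τ with σ P = Q τ, where
-- P = c₁^i x^p y^q c₂^j consists of the symbols of v ℓ that are pushed and Q of those
-- that are popped.  Between the pairs v ℓ ⋯ v ℓ the queue satisfies an invariant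
-- (Regular): every symbol occurs an even number of times, x^ℓ and y^ℓ do not occur
-- before the pair v ℓ ⋯ v ℓ, the last symbol is not c₁, and if it is x then the
-- queue is a power of x.  A block pushing no x (or no y) needs a run of ℓ of them in
-- the queue, so it is the second block of a pair and its run was pushed by the first;
-- with the parities this keeps runs pushed by different blocks apart.  If the queue
-- is empty after a pair, then the second block pushes nothing, and the invariant forces
-- the queue to be empty before the pair and equal to v ℓ in between.
module Submission where

open import Defs
open import Data.Bool using (Bool; true; false; if_then_else_)
open import Data.Fin using (Fin; zero; suc; toℕ)
open import Data.List using (List; []; _∷_; _++_; _∷ʳ_; [_]; length; map; concat; tabulate; initLast; _∷ʳ′_)
open import Data.List.Membership.Propositional using (_∈_)
open import Data.List.Properties
  using (++-assoc; ++-identityʳ; ++-monoid; ++-cancelˡ; ++-conicalʳ; ∷-injective; ∷-injectiveˡ; ∷-injectiveʳ;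
         ∷ʳ-injectiveˡ; ∷ʳ-injectiveʳ; ∷ʳ-++; length-++; length-++-≤ˡ; length-++-≤ʳ; length-map; map-++;
         tabulate-cong)
open import Data.List.Relation.Unary.All as All using (All; []; _∷_)
open import Data.List.Relation.Unary.All.Properties
  using (++⁺; ++⁻ˡ; ++⁻ʳ; ∷ʳ⁺; concat⁺; replicate⁺; tabulate⁺)
open import Data.List.Relation.Unary.Any using (here; there)
open import Data.Nat using (ℕ; zero; suc; _+_; _*_; _∸_; _≤_; _<_; z≤n; s≤s)
open import Data.Nat.Divisibility using (_∣_; _∣0; ∣m∣n⇒∣m+n; ∣m+n∣m⇒∣n; m∣m*n; ∣1⇒≡1)
open import Data.Nat.ListAction using (sum)
open import Data.Nat.ListAction.Properties using (sum-++)
open import Data.Nat.Properties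
  using (≤-trans; ≤-refl; ≤-reflexive; m≤m+n; n≤1+n; n≮n; 1+n≰n; m+n≮n; m<m+n; <⇒≢; ≤⇒≯; suc-injective;
         +-identityʳ; +-suc; +-comm; +-assoc; +-cancelˡ-≡; +-monoʳ-≤; *-zeroʳ; *-suc; module ≤-Reasoning)
open import Data.Nat.Tactic.RingSolver using (solve-∀)
open import Data.Product using (∃; ∃₂; _×_; _,_; proj₁)
open import Data.Sum using (_⊎_; inj₁; inj₂)
open import Function using (_∘_; const)
open import Relation.Binary.Construct.Closure.ReflexiveTransitive using (ε; _◅_)
open import Relation.Binary.PropositionalEquality
  using (_≡_; _≢_; refl; sym; trans; cong; cong₂; subst; subst₂; module ≡-Reasoning)
open import Relation.Nullary using (¬_; contradiction)
open import Tactic.MonoidSolver using (solve)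

private
  variable
    s d z : Symbol
    i j n : ℕ
    g u w t r σ τ σ′ : Word

-- Powers of a symbol and runs inside words.

power-avoids : d ≢ z → ∀ k → All (_≢ z) ([ d ] ^ k)
power-avoids d≢z zero    = []
power-avoids d≢z (suc k) = d≢z ∷ power-avoids d≢z k

length-power : ∀ k → length ([ z ] ^ k) ≡ k
length-power zero    = refl
length-power (suc k) = cong suc (length-power k)

power-∷ʳ : ∀ k → [ z ] ^ suc k ≡ [ z ] ^ k ∷ʳ z
power-∷ʳ zero    = refl
power-∷ʳ (suc k) = cong (_ ∷_) (power-∷ʳ k)

occurs : ∀ u → ¬ All (_≢ d) (u ++ d ∷ w)
occurs u av with d≢d ∷ _ ← ++⁻ʳ u av = contradiction refl d≢d

avoids-last : ∀ u {w t} → All (_≢ d) w → u ++ w ≡ t ∷ʳ d → w ≡ []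
avoids-last u {w} {t} av eq with initLast w
... | []       = refl
... | w₀ ∷ʳ′ g with refl ← ∷ʳ-injectiveʳ (u ++ w₀) t (trans (++-assoc u w₀ [ g ]) eq) = contradiction av (occurs w₀)

-- For positive `n`, this bounds the runs: each run of `z` in `w` is shorter than `n`.
record Free (z : Symbol) (n : ℕ) (w : Word) : Set where
  constructor free
  field absent : ∀ u t → w ≢ u ++ [ z ] ^ n ++ t

open Free

-- A power of `z` cannot contain `d`, so it lies wholly before or wholly after the displayed `d`.
separate : d ≢ z → ∀ n p {s} u {w} → p ++ [ z ] ^ n ++ s ≡ u ++ d ∷ w →
           (∃ λ s′ → u ≡ p ++ [ z ] ^ n ++ s′) ⊎
           (∃ λ p′ → p ≡ u ++ d ∷ p′ × w ≡ p′ ++ [ z ] ^ n ++ s)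
separate d≢z n (g ∷ p) [] eq with refl , eq′ ← ∷-injective eq = inj₂ (p , refl , sym eq′)
separate d≢z n (g ∷ p) (h ∷ u) eq with refl , eq′ ← ∷-injective eq with separate d≢z n p u eq′
... | inj₁ (s′ , eq″)       = inj₁ (s′ , cong (g ∷_) eq″)
... | inj₂ (p′ , eq″ , eq‴) = inj₂ (p′ , cong (g ∷_) eq″ , eq‴)
separate d≢z zero    [] u       eq = inj₁ (u , refl)
separate d≢z (suc n) [] []      eq = contradiction (sym (∷-injectiveˡ eq)) d≢z
separate d≢z (suc n) [] (h ∷ u) eq with refl , eq′ ← ∷-injective eq with separate d≢z n [] u eq′
... | inj₁ (s′ , eq″)     = inj₁ (s′ , cong (h ∷_) eq″)
... | inj₂ (p′ , eq″ , _) with () ← ++-conicalʳ u _ (sym eq″)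

free-suc : Free z n w → Free z (suc n) w
free-suc {z} {n} f .absent u t eq =
  f .absent u (z ∷ t) (trans eq (cong (u ++_) (trans (cong (_++ t) (power-∷ʳ n)) (++-assoc ([ z ] ^ n) [ z ] t))))

free-suffix : ∀ u → Free z n (u ++ w) → Free z n w
free-suffix u f .absent p s refl = f .absent (u ++ p) s (sym (++-assoc u p _))

free-prefix : Free z n (u ++ w) → Free z n u
free-prefix {z} {n} {w = w} f .absent p s refl =
  f .absent p (s ++ w) (trans (++-assoc p ([ z ] ^ n ++ s) w) (cong (p ++_) (++-assoc ([ z ] ^ n) s w)))

free-join : d ≢ z → Free z n u → Free z n w → Free z n (u ++ d ∷ w)
free-join {n = n} {u = u} d≢z f g .absent p s eq with separate d≢z n p u (sym eq)
... | inj₁ (s′ , eq′)     = f .absent p s′ eq′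
... | inj₂ (p′ , _ , eq′) = g .absent p′ s eq′

free-power : ∀ k → k < n → Free z n ([ z ] ^ k)
free-power {n} {z} k k<n .absent p s eq = n≮n k (≤-trans k<n
  (subst₂ _≤_ (length-power n) (trans (cong length (sym eq)) (length-power k))
    (≤-trans (length-++-≤ˡ ([ z ] ^ n)) (length-++-≤ʳ ([ z ] ^ n ++ s) {p}))))

free-[] : Free z (suc n) []
free-[] .absent []      s ()
free-[] .absent (_ ∷ _) s ()

free-++ʳ : Free z (suc n) u → All (_≢ z) t → Free z (suc n) (u ++ t)
free-++ʳ f []         = subst (Free _ _) (sym (++-identityʳ _)) f
free-++ʳ f (d≢z ∷ av) = free-join d≢z f (free-++ʳ free-[] av)

free-++ˡ : All (_≢ z) t → Free z (suc n) u → Free z (suc n) (t ++ u)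
free-++ˡ []         f = f
free-++ˡ (d≢z ∷ av) f = free-join d≢z free-[] (free-++ˡ av f)

same-run : ∀ p n {R T} → All (_≢ z) R → p ≤ n → [ z ] ^ p ++ R ≡ [ z ] ^ n ++ T → p ≡ n × R ≡ T
same-run zero    zero    av           _         eq   = refl , eq
same-run zero    (suc n) (z≢z ∷ _)    _         refl = contradiction refl z≢z
same-run (suc p) (suc n) av           (s≤s p≤n) eq
  with refl , R≡T ← same-run p n av p≤n (∷-injectiveʳ eq) = refl , R≡T

leading-run : ∀ n p V {R T} → All (_≢ z) R → p ≤ suc n →
              [ z ] ^ p ++ R ≡ V ++ [ z ] ^ suc n ++ T → V ≡ [] × p ≡ suc n × R ≡ T
leading-run n p [] av p≤n eq with p≡n , R≡T ← same-run p (suc n) av p≤n eq = refl , p≡n , R≡T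
leading-run n zero V@(_ ∷ _) av p≤n refl with z≢z ∷ _ ← ++⁻ʳ V av = contradiction refl z≢z
leading-run n (suc p) (_ ∷ V) av p<n eq
  with _ , refl , _ ← leading-run n p V av (≤-trans (n≤1+n p) p<n) (∷-injectiveʳ eq) = contradiction p<n 1+n≰n

-- The long run cannot lie in `u`, so it starts after `d`; there only `[ z ] ^ p` offers any `z`,
-- and `p ≤ suc n` makes it fit exactly. This identifies a popped run with a pushed one.
locate-run : ∀ n V {T} u p {R} → d ≢ z → Free z (suc n) u → All (_≢ z) R → p ≤ suc n →
             u ++ d ∷ ([ z ] ^ p ++ R) ≡ V ++ [ z ] ^ suc n ++ T →
             V ≡ u ∷ʳ d × p ≡ suc n × R ≡ T
locate-run n V u p d≢z f av p≤n eq with separate d≢z (suc n) V u (sym eq)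
... | inj₁ (s′ , eq′) = contradiction eq′ (f .absent V s′)
... | inj₂ (V′ , refl , eq′) with refl , p≡n , R≡T ← leading-run n p V′ av p≤n eq′ = refl , p≡n , R≡T

-- Reading one block `v ℓ`: symbols pushed, symbols popped, and parity.

weight : (Symbol → ℕ) → Word → ℕ
weight f w = sum (map f w)

weight-++ : ∀ f u w → weight f (u ++ w) ≡ weight f u + weight f w
weight-++ f u w = trans (cong sum (map-++ f u w)) (sum-++ (map f u) (map f w))

weight-power : ∀ f k → weight f ([ z ] ^ k) ≡ k * f z
weight-power f zero    = refl
weight-power f (suc k) = cong (f _ +_) (weight-power f k)

word : ℕ → ℕ → ℕ → ℕ → Word
word i p q j = [ c₁ ] ^ i ++ [ x ] ^ p ++ [ y ] ^ q ++ [ c₂ ] ^ j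

weight-word : ∀ f i p q j → weight f (word i p q j) ≡ i * f c₁ + (p * f x + (q * f y + j * f c₂))
weight-word f i p q j
  rewrite weight-++ f ([ c₁ ] ^ i) ([ x ] ^ p ++ [ y ] ^ q ++ [ c₂ ] ^ j)
        | weight-++ f ([ x ] ^ p) ([ y ] ^ q ++ [ c₂ ] ^ j)
        | weight-++ f ([ y ] ^ q) ([ c₂ ] ^ j)
        | weight-power {c₁} f i | weight-power {x} f p | weight-power {y} f q | weight-power {c₂} f j = refl

-- Unprimed counts are pushes, primed counts are pops. Pushes only append and pops only remove at
-- the front, so one equation between words captures the block without recording the order of its
-- steps.
data Passage (ℓ : ℕ) (σ τ : Word) : Set where
  passage : ∀ i i′ p p′ q q′ j j′ →
            i + i′ ≡ 1 → p + p′ ≡ ℓ → q + q′ ≡ ℓ → j + j′ ≡ 1 →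
            σ ++ word i p q j ≡ word i′ p′ q′ j′ ++ τ → Passage ℓ σ τ

-- The witness is the weight of the pushed part `P`, counted once because it is appended to `σ` and
-- once because it completes `Q` to the symbols of `v ℓ`. Indicator functions `f` later turn this
-- into a count of one symbol.
even-passage : ∀ {ℓ} f → Passage ℓ σ τ → ∃ λ k → weight f σ + 2 * k ≡ weight f (v ℓ) + weight f τ
even-passage {σ} {τ} {ℓ} f (passage i i′ p p′ q q′ j j′ i+i′ p+p′ q+q′ j+j′ eq) = k , (begin
  weight f σ + 2 * k            ≡⟨ arith₁ (weight f σ) k ⟩
  (weight f σ + k) + k
    ≡⟨ cong (_+ k) (trans (sym (weight-++ f σ P)) (trans (cong (weight f) eq) (weight-++ f Q τ))) ⟩
  weight f Q + weight f τ + k   ≡⟨ arith₂ (weight f Q) (weight f τ) k ⟩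
  (k + weight f Q) + weight f τ ≡⟨ cong (_+ weight f τ) complementary ⟩
  weight f (v ℓ) + weight f τ   ∎)
  where
    open ≡-Reasoning
    P = word i p q j
    Q = word i′ p′ q′ j′
    k = weight f P
    arith₁ : ∀ s k → s + 2 * k ≡ (s + k) + k
    arith₁ = solve-∀
    arith₂ : ∀ s t k → s + t + k ≡ (k + s) + t
    arith₂ = solve-∀
    arith₃ : ∀ i i′ p p′ q q′ j j′ a b c d →
             (i * a + (p * b + (q * c + j * d))) + (i′ * a + (p′ * b + (q′ * c + j′ * d))) ≡
             (i + i′) * a + ((p + p′) * b + ((q + q′) * c + (j + j′) * d))
    arith₃ = solve-∀
    complementary : k + weight f Q ≡ weight f (v ℓ)
    complementary = begin
      k + weight f Q ≡⟨ cong₂ _+_ (weight-word f i p q j) (weight-word f i′ p′ q′ j′) ⟩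
      _ ≡⟨ arith₃ i i′ p p′ q q′ j j′ _ _ _ _ ⟩
      _ ≡⟨ sum-eq ⟩
      _ ≡⟨ sym (weight-word f 1 ℓ ℓ 1) ⟩
      weight f (v ℓ) ∎
      where
        sum-eq : (i + i′) * f c₁ + ((p + p′) * f x + ((q + q′) * f y + (j + j′) * f c₂)) ≡
                 1 * f c₁ + (ℓ * f x + (ℓ * f y + 1 * f c₂))
        sum-eq rewrite i+i′ | p+p′ | q+q′ | j+j′ = refl

-- Both blocks contribute the same `weight f (v ℓ)`, which vanishes modulo 2 in the sum.
even-passages : ∀ {ℓ} f → Passage ℓ σ τ → Passage ℓ τ σ′ → 2 ∣ weight f σ → 2 ∣ weight f σ′
even-passages {σ} {τ} {σ′} {ℓ} f π₁ π₂ even with k , eq₁ ← even-passage f π₁ | l , eq₂ ← even-passage f π₂ =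
  ∣m+n∣m⇒∣n (subst (2 ∣_) both (∣m∣n⇒∣m+n even (m∣m*n (k + l)))) (m∣m*n (weight f (v ℓ)))
  where
    open ≡-Reasoning
    a = weight f (v ℓ)
    arith₁ : ∀ s k l → s + 2 * (k + l) ≡ (s + 2 * k) + 2 * l
    arith₁ = solve-∀
    arith₂ : ∀ a t → a + (a + t) ≡ 2 * a + t
    arith₂ = solve-∀
    both : weight f σ + 2 * (k + l) ≡ 2 * a + weight f σ′
    both = begin
      weight f σ + 2 * (k + l)         ≡⟨ arith₁ (weight f σ) k l ⟩
      (weight f σ + 2 * k) + 2 * l     ≡⟨ cong (_+ 2 * l) eq₁ ⟩
      a + weight f τ + 2 * l           ≡⟨ +-assoc a _ _ ⟩
      a + (weight f τ + 2 * l)         ≡⟨ cong (a +_) eq₂ ⟩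
      a + (a + weight f σ′)            ≡⟨ arith₂ a _ ⟩
      2 * a + weight f σ′              ∎

bit : ∀ i {i′} → i + i′ ≡ 1 → (i ≡ 0 × i′ ≡ 1) ⊎ (i ≡ 1 × i′ ≡ 0)
bit zero          refl = inj₁ (refl , refl)
bit (suc zero)    refl = inj₂ (refl , refl)

compose : ∀ (p q : Word) {p′ q′} → u ++ p ≡ p′ ++ t → t ++ q ≡ q′ ++ r → u ++ p ++ q ≡ (p′ ++ q′) ++ r
compose {u} {t} {r} p q {p′} {q′} eq₁ eq₂ = begin
  u ++ p ++ q     ≡⟨ sym (++-assoc u p q) ⟩
  (u ++ p) ++ q   ≡⟨ cong (_++ q) eq₁ ⟩
  (p′ ++ t) ++ q  ≡⟨ ++-assoc p′ t q ⟩
  p′ ++ t ++ q    ≡⟨ cong (p′ ++_) eq₂ ⟩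
  p′ ++ q′ ++ r   ≡⟨ sym (++-assoc p′ q′ r) ⟩
  (p′ ++ q′) ++ r ∎
  where open ≡-Reasoning

reassoc₁ : ∀ (s a p q c t : Word) → s ++ (a ++ p ++ q ++ c) ++ t ≡ (s ++ a) ++ p ++ q ++ c ++ t
reassoc₁ s a p q c t = solve (++-monoid Symbol)

reassoc₂ : ∀ (s a p q c t : Word) → s ++ (a ++ p ++ q ++ c) ++ t ≡ (s ++ a ++ p) ++ q ++ c ++ t
reassoc₂ s a p q c t = solve (++-monoid Symbol)

reassoc₃ : ∀ (s a p u q c t : Word) → s ++ (a ++ (p ++ u) ++ q ++ c) ++ t ≡ (s ++ a ++ p) ++ u ++ q ++ c ++ t
reassoc₃ s a p u q c t = solve (++-monoid Symbol)

reassoc₄ : ∀ (s a p q c : Word) → s ++ a ++ p ++ q ++ c ≡ (s ++ a ++ p ++ q) ++ c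
reassoc₄ s a p q c = solve (++-monoid Symbol)

word-avoids-x : ∀ i q j → All (_≢ x) (word i 0 q j)
word-avoids-x i q j = ++⁺ (power-avoids (λ ()) i) (++⁺ (power-avoids (λ ()) q) (power-avoids (λ ()) j))

word-avoids-y : ∀ i p j → All (_≢ y) (word i p 0 j)
word-avoids-y i p j = ++⁺ (power-avoids (λ ()) i) (++⁺ (power-avoids (λ ()) p) (power-avoids (λ ()) j))

word-avoids-c₂ : ∀ i p q → All (_≢ c₂) (word i p q 0)
word-avoids-c₂ i p q = ++⁺ (power-avoids (λ ()) i) (++⁺ (power-avoids (λ ()) p) (++⁺ (power-avoids (λ ()) q) []))

-- The queue invariant and the first block of a pair.

-- Regular n holds of the queue before the pair of blocks v (suc n).
record Regular (n : ℕ) (σ : Word) : Set where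
  field
    even    : ∀ f → 2 ∣ weight f σ
    free-x  : Free x (suc n) σ
    free-y  : Free y (suc n) σ
    last-c₁ : ∀ u → σ ≢ u ∷ʳ c₁
    last-x  : ∀ u → σ ≡ u ∷ʳ x → ∃ λ k → σ ≡ [ x ] ^ k

-- Otherwise the block pops `suc n` consecutive `x`, but `σ` has no such run and the symbols
-- appended to it contain no `x`.
pushes-x : ∀ i p q j {i′ p′ q′ j′} → Free x (suc n) σ → p + p′ ≡ suc n →
           σ ++ word i p q j ≡ word i′ p′ q′ j′ ++ τ → ∃ λ k → p ≡ suc k
pushes-x i (suc k) q j f _ _ = k , refl
pushes-x {n} {τ = τ} i zero q j {i′} {_} {q′} {j′} f refl eq = contradiction
  (trans eq (reassoc₁ [] ([ c₁ ] ^ i′) ([ x ] ^ suc n) ([ y ] ^ q′) ([ c₂ ] ^ j′) τ))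
  (free-++ʳ f (word-avoids-x i q j) .absent ([ c₁ ] ^ i′) _)

pushes-y : ∀ i p q j {i′ p′ q′ j′} → Free y (suc n) σ → q + q′ ≡ suc n →
           σ ++ word i p q j ≡ word i′ p′ q′ j′ ++ τ → ∃ λ k → q ≡ suc k
pushes-y i p (suc k) j f _ _ = k , refl
pushes-y {n} {τ = τ} i p zero j {i′} {p′} {_} {j′} f refl eq = contradiction
  (trans eq (reassoc₂ [] ([ c₁ ] ^ i′) ([ x ] ^ p′) ([ y ] ^ suc n) ([ c₂ ] ^ j′) τ))
  (free-++ʳ f (word-avoids-y i p j) .absent ([ c₁ ] ^ i′ ++ [ x ] ^ p′) _)

power-x-starts : ∀ k → [ x ] ^ k ++ x ∷ u ≢ c₁ ∷ w
power-x-starts zero    ()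
power-x-starts (suc k) ()

-- The run of x pushed by the first block does not prolong a run of the queue.
x-boundary : ∀ i k q j {i′ p′ q′ j′} → Regular n σ → i + i′ ≡ 1 →
             σ ++ word i (suc k) q j ≡ word i′ p′ q′ j′ ++ τ →
             ∃₂ λ σ₀ d → σ ++ [ c₁ ] ^ i ≡ σ₀ ∷ʳ d × d ≢ x × Free x (suc n) σ₀
x-boundary {σ = σ} i k q j R i+i′ eq with bit i i+i′
... | inj₂ (refl , refl) = σ , c₁ , refl , (λ ()) , Regular.free-x R
... | inj₁ (refl , refl) with initLast σ
...   | []       = contradiction eq λ ()
...   | σ₀ ∷ʳ′ d = σ₀ , d , ++-identityʳ _ , d≢x , free-prefix (Regular.free-x R)
  where
  d≢x : d ≢ x
  -- Here the block pops `c₁`. If `σ` ended in `x`, it would be a power of `x` by `last-x`, so the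
  -- first symbol popped would be `x` instead.
  d≢x refl with l , eq′ ← Regular.last-x R σ₀ refl = power-x-starts l (trans (cong (_++ word 0 (suc k) q j) (sym eq′)) eq)

-- Both blocks of a pair: preservation of the invariant and the case of an empty queue.

word≡[] : ∀ i p q → word i p q 0 ≡ [] → i ≡ 0 × p ≡ 0 × q ≡ 0
word≡[] zero zero zero _ = refl , refl , refl

zero-or-suc : ∀ m → m ≡ 0 ⊎ ∃ λ k → m ≡ suc k
zero-or-suc zero    = inj₁ refl
zero-or-suc (suc k) = inj₂ (k , refl)

none-left : ∀ {m k} → m + k ≡ m → k ≡ 0
none-left {m} {k} eq = +-cancelˡ-≡ m k 0 (trans eq (sym (+-identityʳ m)))

-- Subscripts 1 and 2 refer to the first and the second block. The counts `suc k` and `suc l` record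
-- that the first block pushes some `x` and some `y`, as `pushes-x` and `pushes-y` guarantee.
module TwoPassages
  {n : ℕ} {σ τ σ′ : Word} (R : Regular n σ)
  (i₁ {i₁′} k {p₁′} l {q₁′} j₁ {j₁′} : ℕ)
  (i₁+i₁′ : i₁ + i₁′ ≡ 1) (p₁+p₁′ : suc k + p₁′ ≡ suc n)
  (q₁+q₁′ : suc l + q₁′ ≡ suc n) (j₁+j₁′ : j₁ + j₁′ ≡ 1)
  (eq₁ : σ ++ word i₁ (suc k) (suc l) j₁ ≡ word i₁′ p₁′ q₁′ j₁′ ++ τ)
  (i₂ {i₂′} p₂ {p₂′} q₂ {q₂′} j₂ {j₂′} : ℕ)
  (i₂+i₂′ : i₂ + i₂′ ≡ 1) (p₂+p₂′ : p₂ + p₂′ ≡ suc n)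
  (q₂+q₂′ : q₂ + q₂′ ≡ suc n) (j₂+j₂′ : j₂ + j₂′ ≡ 1)
  (eq₂ : τ ++ word i₂ p₂ q₂ j₂ ≡ word i₂′ p₂′ q₂′ j₂′ ++ σ′)
  where

  open Regular R
  open ≡-Reasoning

  P₁ = word i₁ (suc k) (suc l) j₁
  Q₁ = word i₁′ p₁′ q₁′ j₁′
  P₂ = word i₂ p₂ q₂ j₂
  Q₂ = word i₂′ p₂′ q₂′ j₂′

  k<n+1 : suc k ≤ suc n
  k<n+1 = ≤-trans (m≤m+n (suc k) p₁′) (≤-reflexive p₁+p₁′)

  l<n+1 : suc l ≤ suc n
  l<n+1 = ≤-trans (m≤m+n (suc l) q₁′) (≤-reflexive q₁+q₁′)

  p₂≤n+1 : p₂ ≤ suc n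
  p₂≤n+1 = ≤-trans (m≤m+n p₂ p₂′) (≤-reflexive p₂+p₂′)

  q₂≤n+1 : q₂ ≤ suc n
  q₂≤n+1 = ≤-trans (m≤m+n q₂ q₂′) (≤-reflexive q₂+q₂′)

  combined : σ ++ P₁ ++ P₂ ≡ Q₁ ++ Q₂ ++ σ′
  combined = trans (compose {σ} {τ} {σ′} P₁ P₂ {Q₁} {Q₂} eq₁ eq₂) (++-assoc Q₁ Q₂ σ′)

  -- The second block then pops a run of `suc n` symbols `x`. In `σ ++ P₁ ++ P₂` the only such run
  -- is the one pushed by the first block, so that run is complete and the words preceding it on the
  -- two sides agree.
  all-x-popped : p₂ ≡ 0 → suc k ≡ suc n × Q₁ ++ [ c₁ ] ^ i₂′ ≡ σ ++ [ c₁ ] ^ i₁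
  all-x-popped refl with refl ← trans p₂+p₂′ refl
    with σ₀ , d , last , d≢x , f ← x-boundary i₁ k (suc l) j₁ {p′ = p₁′} {q₁′} {j₁′} R i₁+i₁′ eq₁
    with V≡ , p≡ , _ ← locate-run n (Q₁ ++ [ c₁ ] ^ i₂′) σ₀ (suc k) d≢x f
           (++⁺ (power-avoids (λ ()) (suc l)) (++⁺ (power-avoids (λ ()) j₁) (word-avoids-x i₂ q₂ j₂))) k<n+1
           (begin
             σ₀ ++ d ∷ [ x ] ^ suc k ++ [ y ] ^ suc l ++ [ c₂ ] ^ j₁ ++ P₂ ≡⟨ sym (∷ʳ-++ σ₀ d _) ⟩
             σ₀ ∷ʳ d ++ [ x ] ^ suc k ++ [ y ] ^ suc l ++ [ c₂ ] ^ j₁ ++ P₂ ≡⟨ cong (_++ _) (sym last) ⟩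
             (σ ++ [ c₁ ] ^ i₁) ++ [ x ] ^ suc k ++ [ y ] ^ suc l ++ [ c₂ ] ^ j₁ ++ P₂
               ≡⟨ sym (reassoc₁ σ ([ c₁ ] ^ i₁) ([ x ] ^ suc k) ([ y ] ^ suc l) ([ c₂ ] ^ j₁) P₂) ⟩
             σ ++ P₁ ++ P₂ ≡⟨ combined ⟩
             Q₁ ++ Q₂ ++ σ′ ≡⟨ reassoc₁ Q₁ ([ c₁ ] ^ i₂′) ([ x ] ^ suc n) ([ y ] ^ q₂′) ([ c₂ ] ^ j₂′) σ′ ⟩
             (Q₁ ++ [ c₁ ] ^ i₂′) ++ [ x ] ^ suc n ++ [ y ] ^ q₂′ ++ [ c₂ ] ^ j₂′ ++ σ′ ∎)
    = p≡ , trans V≡ (sym last)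

  -- The analogue for `y`, this time comparing what follows the run.
  all-y-popped : q₂ ≡ 0 → suc l ≡ suc n × [ c₂ ] ^ j₁ ++ word i₂ p₂ 0 j₂ ≡ [ c₂ ] ^ j₂′ ++ σ′
  all-y-popped refl with refl ← trans q₂+q₂′ refl
    -- The last `x` pushed by the first block is split off to serve as the letter in front of its
    -- run of `y`.
    with _ , q≡ , R≡ ← locate-run n (Q₁ ++ [ c₁ ] ^ i₂′ ++ [ x ] ^ p₂′) (σ ++ [ c₁ ] ^ i₁ ++ [ x ] ^ k) (suc l) (λ ())
           (free-++ʳ free-y (++⁺ (power-avoids (λ ()) i₁) (power-avoids (λ ()) k)))
           (++⁺ (power-avoids (λ ()) j₁) (word-avoids-y i₂ p₂ j₂)) l<n+1
           (begin
             (σ ++ [ c₁ ] ^ i₁ ++ [ x ] ^ k) ++ [ x ] ++ [ y ] ^ suc l ++ [ c₂ ] ^ j₁ ++ P₂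
               ≡⟨ sym (reassoc₃ σ ([ c₁ ] ^ i₁) ([ x ] ^ k) [ x ] ([ y ] ^ suc l) ([ c₂ ] ^ j₁) P₂) ⟩
             σ ++ ([ c₁ ] ^ i₁ ++ ([ x ] ^ k ∷ʳ x) ++ [ y ] ^ suc l ++ [ c₂ ] ^ j₁) ++ P₂
               ≡⟨ cong (λ r → σ ++ ([ c₁ ] ^ i₁ ++ r ++ [ y ] ^ suc l ++ [ c₂ ] ^ j₁) ++ P₂) (sym (power-∷ʳ k)) ⟩
             σ ++ P₁ ++ P₂ ≡⟨ combined ⟩
             Q₁ ++ Q₂ ++ σ′ ≡⟨ reassoc₂ Q₁ ([ c₁ ] ^ i₂′) ([ x ] ^ p₂′) ([ y ] ^ suc n) ([ c₂ ] ^ j₂′) σ′ ⟩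
             (Q₁ ++ [ c₁ ] ^ i₂′ ++ [ x ] ^ p₂′) ++ [ y ] ^ suc n ++ [ c₂ ] ^ j₂′ ++ σ′ ∎)
    = q≡ , R≡

  -- The queue `σ′` is a suffix of `σ ++ P₁ ++ P₂`. There each pushed run of `x` has length at most
  -- `suc n`; the boundary letter `d` and the `y` pushed by the first block keep the runs apart.
  free-x′ : Free x (suc (suc n)) σ′
  free-x′ with σ₀ , d , last , d≢x , f ← x-boundary i₁ k (suc l) j₁ {p′ = p₁′} {q₁′} {j₁′} R i₁+i₁′ eq₁ =
    free-suffix Q₂ (free-suffix Q₁ (subst (Free x (suc (suc n))) (begin
        σ₀ ++ d ∷ [ x ] ^ suc k ++ rest                   ≡⟨ sym (∷ʳ-++ σ₀ d _) ⟩
        σ₀ ∷ʳ d ++ [ x ] ^ suc k ++ rest                  ≡⟨ cong (_++ [ x ] ^ suc k ++ rest) (sym last) ⟩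
        (σ ++ [ c₁ ] ^ i₁) ++ [ x ] ^ suc k ++ rest
          ≡⟨ sym (reassoc₁ σ ([ c₁ ] ^ i₁) ([ x ] ^ suc k) ([ y ] ^ suc l) ([ c₂ ] ^ j₁) P₂) ⟩
        σ ++ P₁ ++ P₂                                     ≡⟨ combined ⟩
        Q₁ ++ Q₂ ++ σ′                                    ∎)
      (free-join d≢x (free-suc f) (free-join (λ ()) (free-power (suc k) (s≤s k<n+1))
        (free-++ˡ (power-avoids (λ ()) l) (free-++ˡ (power-avoids (λ ()) j₁) (free-++ˡ (power-avoids (λ ()) i₂)
          (free-++ʳ (free-power p₂ (s≤s p₂≤n+1)) (++⁺ (power-avoids (λ ()) q₂) (power-avoids (λ ()) j₂))))))))))
    where
    rest = [ y ] ^ suc l ++ [ c₂ ] ^ j₁ ++ P₂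

  -- If the runs of y pushed by the two blocks were adjacent, then c₂ would occur exactly once in σ.
  y-runs-separated : ¬ (j₁ ≡ 0 × i₂ ≡ 0 × p₂ ≡ 0)
  y-runs-separated (refl , refl , refl) with refl ← trans j₁+j₁′ refl | refl ← trans i₂+i₂′ refl | all-x-popped refl
  ... | refl , eq with refl ← none-left p₁+p₁′
    with bit i₁ i₁+i₁′
  -- In this case `σ` would have the form `c₁ y ⋯ y c₂ c₁`, which `last-c₁` excludes.
  ... | inj₁ (refl , refl) = last-c₁ (c₁ ∷ [ y ] ^ q₁′ ++ [ c₂ ]) (trans (sym (++-identityʳ σ)) (sym eq))
  ... | inj₂ (refl , refl) = contradiction (∣1⇒≡1 (subst (2 ∣_) weight≡1 (even is-c₂))) λ ()
    where
    is-c₂ : Symbol → ℕ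
    is-c₂ c₂ = 1
    is-c₂ _  = 0
    weight≡1 : weight is-c₂ σ ≡ 1
    weight≡1 = begin
      weight is-c₂ σ ≡⟨ cong (weight is-c₂) (sym (∷ʳ-injectiveˡ ([ y ] ^ q₁′ ++ [ c₂ ]) σ eq)) ⟩
      weight is-c₂ ([ y ] ^ q₁′ ++ [ c₂ ]) ≡⟨ weight-++ is-c₂ ([ y ] ^ q₁′) [ c₂ ] ⟩
      weight is-c₂ ([ y ] ^ q₁′) + 1 ≡⟨ cong (_+ 1) (weight-power is-c₂ q₁′) ⟩
      q₁′ * 0 + 1 ≡⟨ cong (_+ 1) (*-zeroʳ q₁′) ⟩
      1 ∎

  -- An `x` of the first block cuts off the runs inside `σ`. Between the two pushed runs of `y`
  -- stands a `c₂` of the first block or a `c₁` or `x` of the second; `middle` uses the first of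
  -- these that is present.
  free-y′ : Free y (suc (suc n)) σ′
  free-y′ = free-suffix Q₂ (free-suffix Q₁ (subst (Free y (suc (suc n)))
      (trans (sym (reassoc₁ σ ([ c₁ ] ^ i₁) ([ x ] ^ suc k) ([ y ] ^ suc l) ([ c₂ ] ^ j₁) P₂)) combined)
      (free-join (λ ()) (free-++ʳ (free-suc free-y) (power-avoids (λ ()) i₁)) (free-++ˡ (power-avoids (λ ()) k)
        (middle j₁ i₂ p₂ y-runs-separated)))))
    where
    middle : ∀ j i p → ¬ (j ≡ 0 × i ≡ 0 × p ≡ 0) →
             Free y (suc (suc n)) ([ y ] ^ suc l ++ [ c₂ ] ^ j ++ word i p q₂ j₂)
    first : Free y (suc (suc n)) ([ y ] ^ suc l)
    first = free-power (suc l) (s≤s l<n+1)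
    second : Free y (suc (suc n)) ([ y ] ^ q₂ ++ [ c₂ ] ^ j₂)
    second = free-++ʳ (free-power q₂ (s≤s q₂≤n+1)) (power-avoids (λ ()) j₂)
    middle (suc j) i p _ = free-join (λ ()) first 
      (free-++ˡ (power-avoids (λ ()) j) (free-++ˡ (power-avoids (λ ()) i) (free-++ˡ (power-avoids (λ ()) p) second)))
    middle zero (suc i) p _ = free-join (λ ()) first
      (free-++ˡ (power-avoids (λ ()) i) (free-++ˡ (power-avoids (λ ()) p) second))
    middle zero zero (suc p) _ = free-join (λ ()) first (free-++ˡ (power-avoids (λ ()) p) second)
    middle zero zero zero ¬sep = contradiction (refl , refl , refl) ¬sep

  -- A second block that pushes `c₂` or `y` determines the last symbol. Otherwise `all-y-popped`
  -- reduces `σ′` to `word i₂ p₂ 0 0`, and parity forbids a single `c₁`. Both conditions on the last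
  -- symbol in `Regular` follow from this.
  power-unless-y-c₂ : ∀ u g → g ≢ y → g ≢ c₂ → (∀ f → 2 ∣ weight f σ′) → σ′ ≡ u ∷ʳ g → ∃ λ m → σ′ ≡ [ x ] ^ m
  power-unless-y-c₂ u g g≢y g≢c₂ even′ refl with bit j₂ j₂+j₂′
  ... | inj₂ (refl , refl) = contradiction (∷ʳ-injectiveʳ (Q₂ ++ u) _
          (trans (++-assoc Q₂ u [ g ]) (trans (sym eq₂) (reassoc₄ τ ([ c₁ ] ^ i₂) ([ x ] ^ p₂) ([ y ] ^ q₂) [ c₂ ])))) g≢c₂
  ... | inj₁ (refl , refl) with zero-or-suc q₂
  ...   | inj₂ (m , refl) = contradiction (∷ʳ-injectiveʳ (Q₂ ++ u) (τ ++ [ c₁ ] ^ i₂ ++ [ x ] ^ p₂ ++ [ y ] ^ m) (begin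
            (Q₂ ++ u) ∷ʳ g ≡⟨ ++-assoc Q₂ u [ g ] ⟩
            Q₂ ++ u ∷ʳ g ≡⟨ sym eq₂ ⟩
            τ ++ [ c₁ ] ^ i₂ ++ [ x ] ^ p₂ ++ [ y ] ^ suc m ++ []
              ≡⟨ cong (λ r → τ ++ [ c₁ ] ^ i₂ ++ [ x ] ^ p₂ ++ r) (trans (++-identityʳ _) (power-∷ʳ m)) ⟩
            τ ++ [ c₁ ] ^ i₂ ++ [ x ] ^ p₂ ++ [ y ] ^ m ∷ʳ y
              ≡⟨ reassoc₄ τ ([ c₁ ] ^ i₂) ([ x ] ^ p₂) ([ y ] ^ m) [ y ] ⟩
            (τ ++ [ c₁ ] ^ i₂ ++ [ x ] ^ p₂ ++ [ y ] ^ m) ∷ʳ y ∎)) g≢y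
  ...   | inj₁ refl with all-y-popped refl | bit j₁ j₁+j₁′
  -- The `c₂` popped by the second block lies behind the run of `y`, where no `c₂` was pushed.
  ...     | _ , R≡ | inj₁ (refl , refl) = contradiction (subst (All (_≢ c₂)) R≡ (word-avoids-c₂ i₂ p₂ 0)) (occurs [])
  ...     | _ , R≡ | inj₂ (refl , refl) with bit i₂ i₂+i₂′
  ...       | inj₁ (refl , refl) = p₂ , trans (sym (∷-injectiveʳ R≡)) (++-identityʳ _)
  ...       | inj₂ (refl , refl) = contradiction (∣1⇒≡1 (subst (2 ∣_) weight≡1 (even′ is-c₁))) λ ()
    where
    is-c₁ : Symbol → ℕ
    is-c₁ c₁ = 1
    is-c₁ _  = 0
    weight≡1 : weight is-c₁ σ′ ≡ 1
    weight≡1 = begin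
      weight is-c₁ σ′ ≡⟨ cong (weight is-c₁) (sym (∷-injectiveʳ R≡)) ⟩
      weight is-c₁ (word 1 p₂ 0 0) ≡⟨ weight-word is-c₁ 1 p₂ 0 0 ⟩
      1 + (p₂ * 0 + 0) ≡⟨ cong suc (trans (+-identityʳ _) (*-zeroʳ p₂)) ⟩
      1 ∎

  regular′ : (∀ f → 2 ∣ weight f σ′) → Regular (suc n) σ′
  regular′ even′ = record
    { even    = even′
    ; free-x  = free-x′
    ; free-y  = free-y′
    ; last-c₁ = λ u eq → let m , eq′ = power-unless-y-c₂ u c₁ (λ ()) (λ ()) even′ eq in
                occurs u (subst (All (_≢ c₁)) (trans (sym eq′) eq) (power-avoids (λ ()) m))
    ; last-x  = λ u eq → power-unless-y-c₂ u x (λ ()) (λ ()) even′ eq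
    }

  -- The argument runs backwards: the second block pushes nothing and pops all of `v (suc n)`, so
  -- both runs of the first block are complete and its `c₂` is pushed; only the choice for its `c₁`
  -- remains.
  emptied : σ′ ≡ [] → σ ≡ [] × τ ≡ v (suc n)
  emptied refl with bit j₂ j₂+j₂′
  ... | inj₂ (refl , refl) = contradiction
          (subst (All (_≢ c₂))
            (trans (sym (++-identityʳ Q₂)) (trans (sym eq₂) (reassoc₄ τ ([ c₁ ] ^ i₂) ([ x ] ^ p₂) ([ y ] ^ q₂) [ c₂ ])))
            (word-avoids-c₂ i₂′ p₂′ q₂′))
          (occurs (τ ++ [ c₁ ] ^ i₂ ++ [ x ] ^ p₂ ++ [ y ] ^ q₂))
  -- The popped word `Q₂` ends in `c₂` while `P₂` contains no `c₂`, so `P₂` is empty.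
  ... | inj₁ (refl , refl) with refl , refl , refl ← word≡[] i₂ p₂ q₂ (avoids-last τ (word-avoids-c₂ i₂ p₂ q₂)
                                (trans eq₂ (trans (++-identityʳ Q₂) (reassoc₄ [] ([ c₁ ] ^ i₂′) ([ x ] ^ p₂′) ([ y ] ^ q₂′) [ c₂ ]))))
      with refl ← trans i₂+i₂′ refl | refl ← trans p₂+p₂′ refl | refl ← trans q₂+q₂′ refl
      with all-x-popped refl | all-y-popped refl | bit j₁ j₁+j₁′
  ... | _ , _ | _ , () | inj₁ (refl , refl)
  ... | refl , x≡ | refl , _ | inj₂ (refl , refl)
      with refl ← none-left p₁+p₁′
         | refl ← none-left q₁+q₁′
      with bit i₁ i₁+i₁′
  -- A popped `c₁` in the first block would force `σ` to be `c₁ c₁`.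
  ... | inj₁ (refl , refl) = contradiction (trans (sym (++-identityʳ σ)) (sym x≡)) (last-c₁ [ c₁ ])
  ... | inj₂ (refl , refl) = sym (∷ʳ-injectiveˡ [] σ x≡) , trans (sym (++-identityʳ τ)) (trans eq₂ (++-identityʳ Q₂))

passages : Regular n σ → Passage (suc n) σ τ → Passage (suc n) τ σ′ →
           Regular (suc n) σ′ × (σ′ ≡ [] → σ ≡ [] × τ ≡ v (suc n))
passages R π₁@(passage i₁ i₁′ p₁ p₁′ q₁ q₁′ j₁ j₁′ i₁+i₁′ p₁+p₁′ q₁+q₁′ j₁+j₁′ eq₁)
           π₂@(passage i₂ i₂′ p₂ p₂′ q₂ q₂′ j₂ j₂′ i₂+i₂′ p₂+p₂′ q₂+q₂′ j₂+j₂′ eq₂)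
  with k , refl ← pushes-x i₁ p₁ q₁ j₁ {i₁′} {p₁′} {q₁′} {j₁′} (Regular.free-x R) p₁+p₁′ eq₁
     | l , refl ← pushes-y i₁ p₁ q₁ j₁ {i₁′} {p₁′} {q₁′} {j₁′} (Regular.free-y R) q₁+q₁′ eq₁
  = regular′ (λ f → even-passages f π₁ π₂ (Regular.even R f)) , emptied
  where open TwoPassages R i₁ {i₁′} k {p₁′} l {q₁′} j₁ {j₁′} i₁+i₁′ p₁+p₁′ q₁+q₁′ j₁+j₁′ eq₁
                           i₂ {i₂′} p₂ {p₂′} q₂ {q₂′} j₂ {j₂′} i₂+i₂′ p₂+p₂′ q₂+q₂′ j₂+j₂′ eq₂

regular-[] : Regular 0 []
regular-[] = record
  { even    = λ f → 2 ∣0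
  ; free-x  = free-[]
  ; free-y  = free-[]
  ; last-c₁ = λ { [] () ; (_ ∷ _) () }
  ; last-x  = λ { [] () ; (_ ∷ _) () }
  }

-- The computation restricted to the symbols of the blocks.

visible : Symbol → Bool
visible c₁ = true
visible c₂ = true
visible x  = true
visible y  = true
visible _  = false

Invisible : Word → Set
Invisible = All (λ s → visible s ≡ false)

Queue : Set
Queue = List (Symbol × ℕ)

symbols : Queue → Word
symbols = map proj₁

entry : Symbol → ℕ → Queue
entry s i = if visible s then [ s , i ] else []

labels : ∀ {Q} → All (const ℕ) Q → Queue
labels []               = []
labels {s ∷ _} (i ∷ is) = entry s i ++ labels is

labels-∷ʳ : ∀ {Q} (is : All (const ℕ) Q) i → labels (∷ʳ⁺ {x = s} is i) ≡ labels is ++ entry s i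
labels-∷ʳ []               i = ++-identityʳ _
labels-∷ʳ {Q = s ∷ _} (h ∷ is) i = 
  trans (cong (entry s h ++_) (labels-∷ʳ is i)) (sym (++-assoc (entry s h) (labels is) _))

label : ℕ → Word → Queue
label i []      = []
label i (s ∷ w) = (s , i) ∷ label (suc i) w

length-∷ʳ : ∀ (L : Queue) {a} → length (L ∷ʳ a) ≡ suc (length L)
length-∷ʳ L = trans (length-++ L) (+-comm (length L) 1)

-- The index counts the pairs already read, so the next block is `v (suc n)`.
Pairs : ℕ → List Word → Word
Pairs n []       = []
Pairs n (g ∷ gs) = v (suc n) ++ g ++ v (suc n) ++ Pairs (suc n) gs

Pairs-++ : ∀ n gs {hs} → Pairs n (gs ++ hs) ≡ Pairs n gs ++ Pairs (n + length gs) hs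
Pairs-++ n [] {hs} = cong (λ k → Pairs k hs) (sym (+-identityʳ n))
Pairs-++ n (g ∷ gs) {hs} = begin
  v (suc n) ++ g ++ v (suc n) ++ Pairs (suc n) (gs ++ hs)
    ≡⟨ cong (λ r → v (suc n) ++ g ++ v (suc n) ++ r) (Pairs-++ (suc n) gs) ⟩
  v (suc n) ++ g ++ v (suc n) ++ Pairs (suc n) gs ++ Pairs (suc n + length gs) hs
    ≡⟨ reassoc (v (suc n)) g (v (suc n)) (Pairs (suc n) gs) _ ⟩
  Pairs n (g ∷ gs) ++ Pairs (suc n + length gs) hs
    ≡⟨ cong (λ k → Pairs n (g ∷ gs) ++ Pairs k hs) (sym (+-suc n (length gs))) ⟩
  Pairs n (g ∷ gs) ++ Pairs (n + length (g ∷ gs)) hs ∎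
  where
  open ≡-Reasoning
  reassoc : ∀ (p q r s t : Word) → p ++ q ++ r ++ s ++ t ≡ (p ++ q ++ r ++ s) ++ t
  reassoc p q r s t = solve (++-monoid Symbol)

symbols-[] : ∀ L → symbols L ≡ [] → L ≡ []
symbols-[] [] _ = refl

module Trace (M : List (ℕ × ℕ)) where

  -- A pop compares equal symbols, so erasing invisible ones from the queue leaves a valid
  -- computation. Positions still count all input symbols, and `M` stays fixed so that pieces of a
  -- run refer to the matches of the whole.
  data Run : Queue → ℕ → Word → Queue → Set where
    done : ∀ {L j} → Run L j [] L
    push : ∀ {L j s w K} → visible s ≡ true → Run (L ∷ʳ (s , j)) (suc j) w K → Run L j (s ∷ w) K
    pop  : ∀ {L j s i w K} → visible s ≡ true → (j , i) ∈ M → Run L (suc j) w K → Run ((s , i) ∷ L) j (s ∷ w) K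
    skip : ∀ {L j s w K} → visible s ≡ false → Run L (suc j) w K → Run L j (s ∷ w) K

  private
    variable
      K L : Queue

  read-push : Run (L ++ entry s j) (suc j) w K → Run L j (s ∷ w) K
  read-push {s = s} ρ with visible s in eq
  ... | true  = push eq ρ
  ... | false = skip eq (subst (λ L → Run L _ _ _) (++-identityʳ _) ρ)

  read-pop : (j , i) ∈ M → Run L (suc j) w K → Run (entry s i ++ L) j (s ∷ w) K
  read-pop {s = s} ji∈M ρ with visible s in eq
  ... | true  = pop eq ji∈M ρ
  ... | false = skip eq ρ

  run : ∀ {Q w} (is : All (const ℕ) Q) j (c : Q ∥ w ⊢* [] ∥ []) →
        (∀ {m} → m ∈ matchesFrom is j c → m ∈ M) → Run (labels is) j w []
  run []       j ε              ⊆M = done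
  run is       j (_⊢_.push ◅ c) ⊆M =
    read-push (subst (λ L → Run L _ _ _) (labels-∷ʳ is j) (run (∷ʳ⁺ is j) (suc j) c ⊆M))
  run (i ∷ is) j (_⊢_.pop ◅ c)  ⊆M = read-pop (⊆M (here refl)) (run is (suc j) c (⊆M ∘ there))

  split : ∀ u → Run L j (u ++ w) K → ∃ λ N → Run L j u N × Run N (j + length u) w K
  split {j = j} [] ρ = _ , done , subst (λ j → Run _ j _ _) (sym (+-identityʳ j)) ρ
  split {j = j} (s ∷ u) ρ rewrite +-suc j (length u) with ρ
  ... | push eq ρ     = let N , ρ₁ , ρ₂ = split u ρ in N , push eq ρ₁ , ρ₂
  ... | pop eq ji∈M ρ = let N , ρ₁ , ρ₂ = split u ρ in N , pop eq ji∈M ρ₁ , ρ₂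
  ... | skip eq ρ     = let N , ρ₁ , ρ₂ = split u ρ in N , skip eq ρ₁ , ρ₂

  skips : Invisible u → Run L j u K → L ≡ K
  skips []         done          = refl
  skips (eq ∷ inv) (push eq′ _)  = contradiction (trans (sym eq) eq′) λ ()
  skips (eq ∷ inv) (pop eq′ _ _) = contradiction (trans (sym eq) eq′) λ ()
  skips (eq ∷ inv) (skip _ ρ)    = skips inv ρ

  -- With a single repeated letter, the pushed and the popped subsequence are determined by their
  -- lengths.
  run-power : ∀ k → visible d ≡ true → Run L j ([ d ] ^ k) K →
              ∃₂ λ p p′ → p + p′ ≡ k × symbols L ++ [ d ] ^ p ≡ [ d ] ^ p′ ++ symbols K
  run-power zero _ done = 0 , 0 , refl , ++-identityʳ _
  run-power {d} {L} {j} {K} (suc k) vis (push _ ρ) with p , p′ , eq , eq′ ← run-power k vis ρ =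
    suc p , p′ , cong suc eq ,
    trans (sym (∷ʳ-++ (symbols L) d _)) (trans (cong (_++ [ d ] ^ p) (sym (map-++ proj₁ L [ d , j ]))) eq′)
  run-power {d} (suc k) vis (pop _ _ ρ) with p , p′ , eq , eq′ ← run-power k vis ρ =
    p , suc p′ , trans (+-suc p p′) (cong suc eq) , cong (d ∷_) eq′
  run-power (suc k) vis (skip eq _) = contradiction (trans (sym eq) vis) λ ()

  run-v : ∀ ℓ → Run L j (v ℓ) K → Passage ℓ (symbols L) (symbols K)
  run-v ℓ ρ
    with _ , ρ₁ , ρ ← split [ c₁ ] ρ
    with _ , ρ₂ , ρ ← split ([ x ] ^ ℓ) ρ
    with _ , ρ₃ , ρ₄ ← split ([ y ] ^ ℓ) ρ
    with i , i′ , i+i′ , eq₁ ← run-power 1 refl ρ₁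
       | p , p′ , p+p′ , eq₂ ← run-power ℓ refl ρ₂
       | q , q′ , q+q′ , eq₃ ← run-power ℓ refl ρ₃
       | j , j′ , j+j′ , eq₄ ← run-power 1 refl ρ₄
    = passage i i′ p p′ q q′ j j′ i+i′ p+p′ q+q′ j+j′
        (compose ([ c₁ ] ^ i) _ {[ c₁ ] ^ i′} eq₁ (compose ([ x ] ^ p) _ {[ x ] ^ p′} eq₂
          (compose ([ y ] ^ q) ([ c₂ ] ^ j) {[ y ] ^ q′} eq₃ eq₄)))

  length-run-≤ : Run L j w K → length K ≤ length L + length w
  length-run-≤ {L} done = m≤m+n (length L) 0
  length-run-≤ {L} {w = _ ∷ w} (push _ ρ) = ≤-trans (length-run-≤ ρ)
    (≤-reflexive (trans (cong (_+ length w) (length-∷ʳ L)) (sym (+-suc (length L) (length w)))))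
  length-run-≤ {L = _ ∷ L} {w = _ ∷ w} (pop _ _ ρ) = ≤-trans (length-run-≤ ρ)
    (≤-trans (n≤1+n _) (s≤s (+-monoʳ-≤ (length L) (n≤1+n (length w)))))
  length-run-≤ {L} {w = _ ∷ w} (skip _ ρ) = ≤-trans (length-run-≤ ρ) (+-monoʳ-≤ (length L) (n≤1+n (length w)))

  length-run-≥ : Run L j w K → length L ≤ length K + length w
  length-run-≥ {L} done = m≤m+n (length L) 0
  length-run-≥ {L} {w = _ ∷ w} {K} (push _ ρ) =
    ≤-trans (≤-trans (length-++-≤ˡ L) (length-run-≥ ρ)) (+-monoʳ-≤ (length K) (n≤1+n (length w)))
  length-run-≥ {w = _ ∷ w} {K} (pop _ _ ρ) =
    ≤-trans (s≤s (length-run-≥ ρ)) (≤-reflexive (sym (+-suc (length K) (length w))))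
  length-run-≥ {w = _ ∷ w} {K} (skip _ ρ) =
    ≤-trans (length-run-≥ ρ) (+-monoʳ-≤ (length K) (n≤1+n (length w)))

  -- Each step adds at most one entry, so a gain of `length w` leaves no room for a pop or a skip.
  all-pushed : Run L j w K → length K ≡ length L + length w → K ≡ L ++ label j w
  all-pushed done _ = sym (++-identityʳ _)
  all-pushed {L} {j} {s ∷ w} (push _ ρ) eq =
    trans (all-pushed ρ (trans eq (trans (+-suc (length L) (length w))
            (cong (_+ length w) (sym (length-∷ʳ L))))))
          (++-assoc L [ s , j ] _)
  all-pushed {L = _ ∷ L} {w = _ ∷ w} (pop _ _ ρ) eq =
    contradiction (≤-trans (≤-reflexive (trans (cong suc (sym (+-suc (length L) (length w)))) (sym eq)))
                           (length-run-≤ ρ)) (m+n≮n 1 _)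
  all-pushed {L} {w = _ ∷ w} (skip _ ρ) eq =
    contradiction (≤-trans (≤-reflexive (trans (sym (+-suc (length L) (length w))) (sym eq))) (length-run-≤ ρ)) 1+n≰n

  -- Each step removes at most one entry, so every step must pop; the entries leave in order, and
  -- their positions are consecutive.
  all-popped : ∀ u → L ≡ label i u → Run L j w [] → length L ≡ length w →
               ∀ t → t < length w → (j + t , i + t) ∈ M
  all-popped u _ (push {L = L} {j = j} {s = s} _ ρ) eq _ _ = contradiction
    (≤-trans (length-run-≥ ρ) (≤-trans (n≤1+n _) (≤-reflexive (sym eq))))
    (subst (λ l → ¬ l ≤ length L) (sym (length-∷ʳ L)) 1+n≰n)
  all-popped u _ (skip _ ρ) eq _ _ = contradiction (≤-trans (≤-reflexive (sym eq)) (length-run-≥ ρ)) 1+n≰n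
  all-popped {i = i} {j} (_ ∷ u) refl (pop _ ji∈M ρ) eq zero _ =
    subst₂ (λ j i → (j , i) ∈ M) (sym (+-identityʳ j)) (sym (+-identityʳ i)) ji∈M
  all-popped {i = i} {j} (_ ∷ u) refl (pop _ ji∈M ρ) eq (suc t) (s≤s t<w) =
    subst₂ (λ j i → (j , i) ∈ M) (sym (+-suc j t)) (sym (+-suc i t)) (all-popped u refl ρ (suc-injective eq) t t<w)

  split-pair : ∀ ℓ → Invisible g → Run L j (v ℓ ++ g ++ v ℓ ++ w) K →
               ∃₂ λ N₁ N₂ → Run L j (v ℓ) N₁ ×
                            Run N₁ (j + length (v ℓ) + length g) (v ℓ) N₂ ×
                            Run N₂ (j + length (v ℓ) + length g + length (v ℓ)) w K
  split-pair {g = g} ℓ inv ρ =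
    let N₁ , ρ₁ , ρ′ = split (v ℓ) ρ
        _  , ρg , ρ″ = split g ρ′
        N₂ , ρ₂ , ρ‴ = split (v ℓ) (subst (λ L → Run L _ _ _) (sym (skips inv ρg)) ρ″)
    in N₁ , N₂ , ρ₁ , ρ₂ , ρ‴

  regular-pair : ∀ {N₁ N₂ i j} → Regular n (symbols L) → Run L i (v (suc n)) N₁ → Run N₁ j (v (suc n)) N₂ →
                 Regular (suc n) (symbols N₂) × (N₂ ≡ [] → L ≡ [] × symbols N₁ ≡ v (suc n))
  regular-pair {n} {L} R ρ₁ ρ₂ =
    let R′ , good = passages R (run-v (suc n) ρ₁) (run-v (suc n) ρ₂)
    in R′ , λ eq → let L≡ , N₁≡ = good (cong symbols eq) in symbols-[] L L≡ , N₁≡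

  -- The invariant travels forwards and emptiness backwards, since the queue is known to be empty
  -- only at the end.
  regular-pairs : ∀ gs → All Invisible gs → Regular n (symbols L) → Run L j (Pairs n gs) K →
                  Regular (n + length gs) (symbols K) × (K ≡ [] → L ≡ [])
  regular-pairs {n = n} [] _ R done = subst (λ n → Regular n _) (sym (+-identityʳ n)) R , λ eq → eq
  regular-pairs {n = n} {K = K} (g ∷ gs) (inv ∷ invs) R ρ =
    let _ , _ , ρ₁ , ρ₂ , ρ′ = split-pair (suc n) inv ρ
        R′ , good            = regular-pair R ρ₁ ρ₂
        R″ , empty           = regular-pairs gs invs R′ ρ′
    in subst (λ n → Regular n (symbols K)) (sym (+-suc n (length gs))) R″ , λ eq → proj₁ (good (empty eq))

  matched-pair : ∀ ℓ {N i j} → symbols N ≡ v ℓ → Run [] i (v ℓ) N → Run N j (v ℓ) [] →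
                 ∀ t → t < length (v ℓ) → (j + t , i + t) ∈ M
  matched-pair ℓ {N} N≡ ρ₁ ρ₂ = all-popped (v ℓ) (all-pushed ρ₁ length-N) ρ₂ length-N
    where
    length-N : length N ≡ length (v ℓ)
    length-N = trans (sym (length-map proj₁ N)) (cong length N≡)

  -- Regularity reaches the chosen pair from the start and emptiness from the end. Hence the visible
  -- queue is empty around the pair and spells `v ℓ` in between.
  matched : ∀ gs {g hs} → All Invisible (gs ++ g ∷ hs) → Run [] j (Pairs 0 (gs ++ g ∷ hs)) [] →
            let i = j + length (Pairs 0 gs); ℓ = suc (length gs) in
            ∀ t → t < length (v ℓ) → (i + length (v ℓ) + length g + t , i + t) ∈ M
  matched {j} gs {g} {hs} invs ρ =
    let ℓ = suc (length gs)
        L , ρ₀ , ρ′             = split (Pairs 0 gs) (subst (λ w → Run [] j w []) (Pairs-++ 0 gs) ρ)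
        N₁ , N₂ , ρ₁ , ρ₂ , ρ″ = split-pair ℓ (All.head (++⁻ʳ gs invs)) ρ′
        R , _                   = regular-pairs gs (++⁻ˡ gs invs) regular-[] ρ₀
        R′ , good               = regular-pair R ρ₁ ρ₂
        _ , empty               = regular-pairs hs (All.tail (++⁻ʳ gs invs)) R′ ρ″
        N₂≡[]                   = empty refl
        L≡[] , N₁≡v             = good N₂≡[]
        i                       = j + length (Pairs 0 gs)
    in matched-pair ℓ N₁≡v (subst (λ L → Run L i (v ℓ) N₁) L≡[] ρ₁)
         (subst (Run N₁ (i + length (v ℓ) + length g) (v ℓ)) N₂≡[] ρ₂)

-- Positions of the occurrences of `v ℓ`.

record Avoids (ℓ : ℕ) (u : Word) : Set where
  field past : ∀ {w} p s → u ++ w ≡ p ++ v ℓ ++ s → ∃ λ p′ → p ≡ u ++ p′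

open Avoids

v-avoids : ∀ ℓ → All (_≢ c₁) u → Avoids ℓ u
v-avoids ℓ []        .past p       s eq = p , refl
v-avoids ℓ (≢c₁ ∷ _) .past []      s eq = contradiction (∷-injectiveˡ eq) ≢c₁
v-avoids ℓ (_ ∷ av)  .past (h ∷ p) s eq with refl , eq′ ← ∷-injective eq
  with p′ , refl ← v-avoids ℓ av .past p s eq′ = p′ , refl

-- The arbitrary continuation in `Avoids` matters here: it also excludes occurrences that straddle
-- the end of `u`.
avoids-++ : ∀ {ℓ} → Avoids ℓ u → Avoids ℓ t → Avoids ℓ (u ++ t)
avoids-++ {u} {t} αu αt .past p s eq with p′ , refl ← αu .past p s (trans (sym (++-assoc u t _)) eq)
  with p″ , refl ← αt .past p′ s (++-cancelˡ u _ _ (trans (sym (++-assoc u t _)) (trans eq (++-assoc u p′ _))))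
  = p″ , sym (++-assoc u t p″)

tail-v : ℕ → Word
tail-v ℓ = [ x ] ^ ℓ ++ [ y ] ^ ℓ ++ [ c₂ ]

tail-v-avoids-c₁ : ∀ ℓ → All (_≢ c₁) (tail-v ℓ)
tail-v-avoids-c₁ ℓ = ++⁺ (power-avoids (λ ()) ℓ) (++⁺ (power-avoids (λ ()) ℓ) ((λ ()) ∷ []))

x-run-injective : ∀ k l {s t} → [ x ] ^ k ++ y ∷ s ≡ [ x ] ^ l ++ y ∷ t → k ≡ l
x-run-injective zero    zero    _  = refl
x-run-injective (suc k) (suc l) eq = cong suc (x-run-injective k l (∷-injectiveʳ eq))

v-injective : ∀ k l {s t} → v (suc k) ++ s ≡ v (suc l) ++ t → k ≡ l
v-injective k l {s} {t} eq = suc-injective (x-run-injective (suc k) (suc l)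
  (trans (sym (++-assoc ([ x ] ^ suc k) _ s)) (trans (∷-injectiveʳ eq) (++-assoc ([ x ] ^ suc l) _ t))))

-- The only `c₁` of the block is its first symbol, and an occurrence starting there would have a run
-- of `x` of the wrong length.
v-avoids-v : ∀ {k l} → k ≢ l → Avoids (suc l) (v (suc k))
v-avoids-v k≢l .past []      s eq = contradiction (v-injective _ _ eq) k≢l
v-avoids-v {k} {l} k≢l .past (h ∷ p) s eq with refl , eq′ ← ∷-injective eq
  with p′ , refl ← v-avoids (suc l) (tail-v-avoids-c₁ (suc k)) .past p s eq′ = p′ , refl

invisible-avoids-c₁ : Invisible u → All (_≢ c₁) u
invisible-avoids-c₁ = All.map λ { () refl }

v-avoids-pairs : ∀ n gs {l} → All Invisible gs → n + length gs ≤ l → Avoids (suc l) (Pairs n gs)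
v-avoids-pairs n []       _            _  = v-avoids _ []
v-avoids-pairs n (g ∷ gs) {l} (inv ∷ invs) n+≤l =
  avoids-++ first (avoids-++ (v-avoids _ (invisible-avoids-c₁ inv)) (avoids-++ first
    (v-avoids-pairs (suc n) gs invs (≤-trans (≤-reflexive (sym (+-suc n (length gs)))) n+≤l))))
  where
  first : Avoids (suc l) (v (suc n))
  first = v-avoids-v (<⇒≢ (≤-trans (m<m+n n (s≤s z≤n)) n+≤l))

first-two : ∀ ℓ u g r → Avoids ℓ u → Invisible g →
            FirstTwoOccurrences (v ℓ) (u ++ v ℓ ++ g ++ v ℓ ++ r) (length u) (length u + length (v ℓ) + length g)
first-two ℓ u g r av inv = record
  { i<j     = ≤-trans (m<m+n (length u) (s≤s z≤n)) (m≤m+n (length u + length (v ℓ)) (length g))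
  ; first   = u , _ , refl , refl
  ; second  = (u ++ v ℓ) ++ g , r , reassoc u (v ℓ) g (v ℓ ++ r) ,
              trans (length-++ (u ++ v ℓ)) (cong (_+ length g) (length-++ u))
  ; no-more = no-more
  }
  where
  reassoc : ∀ (p q r s : Word) → p ++ q ++ r ++ s ≡ ((p ++ q) ++ r) ++ s
  reassoc p q r s = solve (++-monoid Symbol)
  no-more : ∀ k → k < length u + length (v ℓ) + length g →
            v ℓ OccursAt k In (u ++ v ℓ ++ g ++ v ℓ ++ r) → k ≡ length u
  no-more _ k<j (p , s , eq , refl) with p′ , refl ← av .past p s eq
    with p′ | ++-cancelˡ u _ _ (trans eq (++-assoc u p′ _))
  ... | []     | _   = cong length (++-identityʳ u)
  ... | h ∷ p″ | eq′
    with refl , eq″ ← ∷-injective eq′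
    -- Behind its initial `c₁`, neither the first copy nor `g` contains `c₁`, so a later occurrence
    -- starts no earlier than the second copy.
    with p‴ , refl ← v-avoids ℓ (++⁺ (tail-v-avoids-c₁ ℓ) (invisible-avoids-c₁ inv)) .past p″ s (trans (++-assoc (tail-v ℓ) g _) eq″)
    = contradiction k<j (≤⇒≯ (begin
        length u + length (v ℓ) + length g                          ≡⟨ +-assoc (length u) _ _ ⟩
        length u + suc (length (tail-v ℓ) + length g)
          ≡⟨ cong (λ l → length u + suc l) (length-++ (tail-v ℓ)) ⟨
        length u + length (c₁ ∷ tail-v ℓ ++ g)                      ≤⟨ +-monoʳ-≤ (length u) (length-++-≤ˡ (c₁ ∷ tail-v ℓ ++ g)) ⟩
        length u + length (c₁ ∷ (tail-v ℓ ++ g) ++ p‴)              ≡⟨ length-++ u ⟨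
        length (u ++ c₁ ∷ (tail-v ℓ ++ g) ++ p‴)                    ∎))
    where open ≤-Reasoning

-- The word `wₛ` as an invisible prefix followed by pairs of blocks.

invisible-^ : ∀ k → Invisible u → Invisible (u ^ k)
invisible-^ k inv = concat⁺ (replicate⁺ k inv)

invisible-U : ∀ ℓ → Invisible (U ℓ)
invisible-U ℓ = refl ∷ refl ∷ ++⁺ (invisible-^ ℓ (refl ∷ [])) (refl ∷ refl ∷ [])

split-at : ∀ {n} (gs : List Word) → n < length gs → ∃₂ λ gs₁ g → ∃ λ gs₂ → gs ≡ gs₁ ++ g ∷ gs₂ × length gs₁ ≡ n
split-at {zero}  (g ∷ gs) _          = [] , g , gs , refl , refl
split-at {suc n} (g ∷ gs) (s≤s n<gs) with gs₁ , h , gs₂ , refl , refl ← split-at gs n<gs = g ∷ gs₁ , h , gs₂ , refl , refl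

gaps : (Fin n → Word) → (Fin n → Word) → (Fin n → Word) → List Word
gaps d f g = concat (tabulate λ i → d i ∷ d i ∷ f i ∷ g i ∷ [])

length-gaps : ∀ {n} (d f g : Fin n → Word) → length (gaps d f g) ≡ n * 4
length-gaps {zero}  d f g = refl
length-gaps {suc n} d f g = cong (4 +_) (length-gaps (d ∘ suc) (f ∘ suc) (g ∘ suc))

block : ℕ → Word → Word → Word → Word
block k d f g = v (k ∸ 3) ++ d ++ v (k ∸ 3) ++ v (k ∸ 2) ++ d ++ v (k ∸ 2) ++ v (k ∸ 1) ++ f ++ v (k ∸ 1) ++ v k ++ g ++ v k

-- The offset `o` makes the induction over `Fin n` possible. Once the index has the form
-- `4 + 4 * o`, the truncated subtractions compute to four successive block numbers.
∏-block : ∀ {n} o (d f g : Fin n → Word) →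
          ∏ (λ i → block (4 * suc (o + toℕ i)) (d i) (f i) (g i)) ≡ Pairs (4 * o) (gaps d f g)
∏-block {zero}  o d f g = refl
∏-block {suc n} o d f g = begin
  block (4 * suc (o + 0)) d₀ f₀ g₀ ++ ∏ (λ i → block (4 * suc (o + suc (toℕ i))) (d (suc i)) (f (suc i)) (g (suc i)))
    ≡⟨ cong₂ (λ k r → block k d₀ f₀ g₀ ++ r) (trans (cong (λ l → 4 * suc l) (+-identityʳ o)) (*-suc 4 o))
         (cong concat (tabulate-cong λ i → cong (λ l → block (4 * suc l) (d (suc i)) (f (suc i)) (g (suc i))) (+-suc o (toℕ i)))) ⟩
  block (4 + 4 * o) d₀ f₀ g₀ ++ ∏ (λ i → block (4 * suc (suc o + toℕ i)) (d (suc i)) (f (suc i)) (g (suc i)))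
    ≡⟨ cong (block (4 + 4 * o) d₀ f₀ g₀ ++_) (∏-block (suc o) (d ∘ suc) (f ∘ suc) (g ∘ suc)) ⟩
  block (4 + 4 * o) d₀ f₀ g₀ ++ Pairs (4 * suc o) rest
    ≡⟨ cong (λ k → block (4 + 4 * o) d₀ f₀ g₀ ++ Pairs k rest) (*-suc 4 o) ⟩
  block (4 + 4 * o) d₀ f₀ g₀ ++ Pairs (4 + 4 * o) rest
    ≡⟨ reassoc (v (1 + 4 * o)) d₀ (v (2 + 4 * o)) (v (3 + 4 * o)) f₀ (v (4 + 4 * o)) g₀ (Pairs (4 + 4 * o) rest) ⟩
  Pairs (4 * o) (gaps d f g) ∎
  where
  open ≡-Reasoning
  d₀ = d zero
  f₀ = f zero
  g₀ = g zero
  rest = gaps (d ∘ suc) (f ∘ suc) (g ∘ suc)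
  reassoc : ∀ (v₁ d v₂ v₃ f v₄ g r : Word) →
            (v₁ ++ d ++ v₁ ++ v₂ ++ d ++ v₂ ++ v₃ ++ f ++ v₃ ++ v₄ ++ g ++ v₄) ++ r ≡
            v₁ ++ d ++ v₁ ++ v₂ ++ d ++ v₂ ++ v₃ ++ f ++ v₃ ++ v₄ ++ g ++ v₄ ++ r
  reassoc v₁ d v₂ v₃ f v₄ g r = solve (++-monoid Symbol)

module _ {m : ℕ} (S : 3-Partition m) where

  open 3-Partition S using (B) renaming (n to size)

  prefix : Word
  prefix = Load S ++ Dist S

  gapsₛ : List Word
  gapsₛ = gaps (D S) (E S) (F S)

  wₛ-pairs : wₛ S ≡ prefix ++ Pairs 0 gapsₛ
  wₛ-pairs = trans (cong (λ r → Load S ++ Dist S ++ r) (∏-block 0 (D S) (E S) (F S)))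
                   (sym (++-assoc (Load S) (Dist S) (Pairs 0 gapsₛ)))

  invisible-prefix : Invisible prefix
  invisible-prefix = ++⁺
    (refl ∷ concat⁺ (tabulate⁺ {n = m} λ _ → ++⁺ (invisible-^ (2 * B) (refl ∷ [])) (refl ∷ [])))
    (refl ∷ concat⁺ (tabulate⁺ {n = m} λ _ → ++⁺ (invisible-^ 3 (refl ∷ ++⁺ (invisible-^ B (refl ∷ [])) (refl ∷ []))) (refl ∷ [])))

  invisible-gaps : All Invisible gapsₛ
  invisible-gaps = concat⁺ (tabulate⁺ λ i → invisible-D i ∷ invisible-D i ∷ invisible-E i ∷ invisible-F i ∷ [])
    where
    invisible-D : ∀ i → Invisible (D S i)
    invisible-D i = invisible-^ (3 * m ∸ suc (toℕ i) + 1) (invisible-U (size i))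
    invisible-E : ∀ i → Invisible (E S i)
    invisible-E i = ++⁺ us (refl ∷ ++⁺ (invisible-^ (size i) (refl ∷ [])) (refl ∷ us))
      where us = invisible-^ (3 * m ∸ suc (toℕ i)) (invisible-U B)
    invisible-F : ∀ i → Invisible (F S i)
    invisible-F i = invisible-^ (2 * (3 * m ∸ suc (toℕ i))) (invisible-U B)

  length-gapsₛ : 12 * m ≡ length gapsₛ
  length-gapsₛ = trans (arith m) (sym (length-gaps (D S) (E S) (F S)))
    where
    arith : ∀ m → 12 * m ≡ 3 * m * 4
    arith = solve-∀

-- The V-Condition for accepting computations.

module _ {m : ℕ} (S : 3-Partition m) (c : AcceptingComputation (wₛ S)) where

  open Trace (matches c)

  V-condition-at : ∀ gs g hs → gapsₛ S ≡ gs ++ g ∷ hs → ∀ {ℓ} → suc (length gs) ≡ ℓ →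
                   ∃₂ λ i j → FirstTwoOccurrences (v ℓ) (wₛ S) i j ×
                              (∀ t → t < length (v ℓ) → (j + t , i + t) ∈ matches c)
  V-condition-at gs g hs gaps≡ refl =
    length before , length before + length (v ℓ) + length g ,
    subst (λ w → FirstTwoOccurrences (v ℓ) w (length before) (length before + length (v ℓ) + length g)) (sym w≡)
      (first-two ℓ before g (Pairs ℓ hs) before-avoids (All.head (++⁻ʳ gs invs))) ,
    λ t t<ℓ → subst (λ l → (l + length (v ℓ) + length g + t , l + t) ∈ matches c) (sym (length-++ (prefix S)))
      (matched gs invs run-pairs t t<ℓ)
    where
    ℓ = suc (length gs)
    before = prefix S ++ Pairs 0 gs
    invs : All Invisible (gs ++ g ∷ hs)
    invs = subst (All Invisible) gaps≡ (invisible-gaps S)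
    w≡pairs : wₛ S ≡ prefix S ++ Pairs 0 (gs ++ g ∷ hs)
    w≡pairs = trans (wₛ-pairs S) (cong (λ gs → prefix S ++ Pairs 0 gs) gaps≡)
    w≡ : wₛ S ≡ before ++ v ℓ ++ g ++ v ℓ ++ Pairs ℓ hs
    w≡ = trans w≡pairs (trans (cong (prefix S ++_) (Pairs-++ 0 gs)) (sym (++-assoc (prefix S) (Pairs 0 gs) _)))
    before-avoids : Avoids ℓ before
    before-avoids = avoids-++ (v-avoids ℓ (invisible-avoids-c₁ (invisible-prefix S)))
                              (v-avoids-pairs 0 gs (++⁻ˡ gs invs) ≤-refl)
    run-pairs : Run [] (length (prefix S)) (Pairs 0 (gs ++ g ∷ hs)) []
    -- The prefix is invisible, so the pairs are read from an empty visible queue, starting at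
    -- position `length (prefix S)`.
    run-pairs = let _ , ρ₀ , ρ = split (prefix S) (subst (λ w → Run [] 0 w []) w≡pairs (run [] 0 c λ m∈ → m∈))
                in subst (λ L → Run L _ _ _) (sym (skips (invisible-prefix S) ρ₀)) ρ

theorem2 : ∀ {m : ℕ} (S : 3-Partition m) (c : AcceptingComputation (wₛ S)) → V-Condition S c
theorem2 S c (suc n) _ n<12m =
  let gs , g , hs , gaps≡ , length≡n = split-at (gapsₛ S) (≤-trans n<12m (≤-reflexive (length-gapsₛ S)))
  in V-condition-at S c gs g hs gaps≡ (cong suc length≡n)
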